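{- For every abstract computation function $T : \mathbb{N} \to \mathbb{N} \to \mathbb{N} \to \mathrm{option}\,\mathbb{N}$, $\mathsf{CT}_T \to \mathsf{EA}$. That is: if for every $f : \mathbb{N} \to \mathbb{N}$ there exists $c : \mathbb{N}$ with $\forall x.\,\exists n.\; T\,c\,x\,n = \mathrm{Some}(f\,x)$, then one can construct $\varphi : \mathbb{N} \to (\mathbb{N} \to \mathrm{option}\,\mathbb{N})$ such that for every $f : \mathbb{N} \to \mathrm{option}\,\mathbb{N}$ there exists $c : \mathbb{N}$ with $\varphi\,c \equiv_{\mathsf{ran}} f$.
   Context: Ambient theory: Coq's type theory (a constructive dependent type theory with a cumulative hierarchy of types $\mathbb{T}$ and a separate impredicative universe $\mathbb{P} \subseteq \mathbb{T}$ of propositions), with no additional axioms (no excluded middle, no choice, no extensionality); the statement is to be proved in this theory. $\exists$ is the propositional existential quantifier (eliminable in general only into propositions), $\Sigma$ is the dependent pair type. An abstract computation function is a function $T : \mathbb{N} \to \mathbb{N} \to \mathbb{N} \to \mathrm{option}\,\mathbb{N}$ (arguments: code $c$, input $x$, step index $n$) that is monotonic: $T\,c\,x\,n_1 = \mathrm{Some}\,y \to \forall n_2 \ge n_1.\; T\,c\,x\,n_2 = \mathrm{Some}\,y$. Define $c \sim f := \forall x.\,\exists n.\; T\,c\,x\,n = \mathrm{Some}(f\,x)$ and $\mathsf{CT}_T := \forall f : \mathbb{N} \to \mathbb{N}.\ \exists c : \mathbb{N}.\ c \sim f$. Range equivalence of $f, g : \mathbb{N} \to \mathrm{option}\,\mathbb{N}$: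 $f \equiv_{\mathsf{ran}} g := \forall x : \mathbb{N}.\ (\exists n.\ f\,n = \mathrm{Some}\,x) \leftrightarrow (\exists n.\ g\,n = \mathrm{Some}\,x)$. $\mathsf{EA} := \Sigma \varphi : \mathbb{N} \to (\mathbb{N} \to \mathrm{option}\,\mathbb{N}).\ \forall f : \mathbb{N} \to \mathrm{option}\,\mathbb{N}.\ \exists c.\ \varphi\,c \equiv_{\mathsf{ran}} f$. -}

module Defs where

open import Data.Maybe.Base using (Maybe; just)
open import Data.Nat.Base using (ℕ; _≥_)
open import Data.Product.Base using (Σ-syntax)
open import Function.Bundles using (_⇔_)
open import Level using (Level; 0ℓ; _⊔_) renaming (suc to lsuc)
open import Relation.Binary.PropositionalEquality.Core using (_≡_)
open import Relation.Nullary using (Irrelevant)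

private
  variable
    a p : Level

-- The propositional existential quantifier, as opposed to Σ: the encoding
-- ∀ Q. (∀ x. P x → Q) → Q of ∃ x. P x, where Q ranges over propositions, i.e.
-- types with at most one element.  The witness is thus only available when
-- constructing an element of a proposition.  (Without the restriction on Q
-- this would amount to Σ for small A and P.)
∃ᵖ : {A : Set a} → (A → Set p) → Set (a ⊔ p ⊔ lsuc 0ℓ)
∃ᵖ {A = A} P = (Q : Set) → Irrelevant Q → ((x : A) → P x → Q) → Q

infix 2 ∃ᵖ-syntax

∃ᵖ-syntax : {A : Set a} → (A → Set p) → Set (a ⊔ p ⊔ lsuc 0ℓ)
∃ᵖ-syntax = ∃ᵖ

syntax ∃ᵖ-syntax (λ x → P) = ∃ᵖ[ x ] P

-- Arguments: code, input, step index.
StepFunction : Set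
StepFunction = ℕ → ℕ → ℕ → Maybe ℕ

IsAbstractComputationFunction : StepFunction → Set
IsAbstractComputationFunction T =
  ∀ c x n₁ y → T c x n₁ ≡ just y → ∀ n₂ → n₂ ≥ n₁ → T c x n₂ ≡ just y

infix 4 _⊢_∼_

_⊢_∼_ : StepFunction → ℕ → (ℕ → ℕ) → Set₁
T ⊢ c ∼ f = ∀ x → ∃ᵖ[ n ] T c x n ≡ just (f x)

CT : StepFunction → Set₁
CT T = ∀ (f : ℕ → ℕ) → ∃ᵖ[ c ] T ⊢ c ∼ f

infix 4 _≡ran_

_≡ran_ : (f g : ℕ → Maybe ℕ) → Set₁
f ≡ran g = ∀ x → (∃ᵖ[ n ] f n ≡ just x) ⇔ (∃ᵖ[ n ] g n ≡ just x)

EA : Set₁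
EA = Σ[ φ ∈ (ℕ → (ℕ → Maybe ℕ)) ] (∀ (f : ℕ → Maybe ℕ) → ∃ᵖ[ c ] φ c ≡ran f)

{-# OPTIONS --safe #-}

-- The code of f is a code c of the total function n ↦ 0 or 1 + f n, and φ c
-- dovetails over all pairs (input, step index), emitting the predecessor of each
-- positive value found.  Monotonicity makes T c single-valued, so nothing
-- outside the range of f is ever emitted.
module Submission where

open import Data.Maybe.Base using (Maybe; just; nothing; _>>=_)
open import Data.Maybe.Properties using (just-injective)
open import Data.Nat.Base using (ℕ; zero; suc; _+_; _⊔_)
open import Data.Nat.Properties using (+-suc; +-identityʳ; m≤m⊔n; m≤n⊔m; suc-injective)
open import Data.Product.Base using (∃-syntax; _×_; _,_; uncurry)
open import Function.Base using (_∘_)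
open import Function.Bundles using (mk⇔)
open import Relation.Binary.PropositionalEquality
  using (_≡_; refl; sym; trans; cong)

open import Defs

-- Cantor's walk through the antidiagonals, each from `(0 , s)` to `(s , 0)`.
next : ℕ × ℕ → ℕ × ℕ
next (a , zero)  = zero , suc a
next (a , suc b) = suc a , b

unpair : ℕ → ℕ × ℕ
unpair zero    = zero , zero
unpair (suc n) = next (unpair n)

unpair-surjective : ∀ a b → ∃[ n ] unpair n ≡ (a , b)
unpair-surjective a b = onDiagonal (a + b) a b refl
  where
  -- Walks backwards along `next`; `s` is explicit so that recursion is lexicographic in `(s , a)`,
  -- as `a` may grow when the diagonal changes.
  onDiagonal : ∀ s a b → a + b ≡ s → ∃[ n ] unpair n ≡ (a , b)
  onDiagonal s zero zero _ = zero , refl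
  onDiagonal (suc s) zero (suc b) eq
    with n , p ← onDiagonal s b zero (trans (+-identityʳ b) (suc-injective eq))
    = suc n , cong next p
  onDiagonal s (suc a) b eq
    with n , p ← onDiagonal s a (suc b) (trans (+-suc a b) eq)
    = suc n , cong next p

encode : Maybe ℕ → ℕ
encode nothing  = zero
encode (just x) = suc x

decode : ℕ → Maybe ℕ
decode zero    = nothing
decode (suc x) = just x

decode-encode : ∀ o → decode (encode o) ≡ o
decode-encode nothing  = refl
decode-encode (just _) = refl

enumerate : StepFunction → ℕ → ℕ → Maybe ℕ
enumerate T c n = uncurry (T c) (unpair n) >>= decode

module _ {T : StepFunction} (mono : IsAbstractComputationFunction T) where

  T-functional : ∀ {c x m n y z} → T c x m ≡ just y → T c x n ≡ just z → y ≡ z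
  T-functional {c} {x} {m} {n} p q = just-injective
    (trans (sym (mono c x m _ p (m ⊔ n) (m≤m⊔n m n)))
           (mono c x n _ q (m ⊔ n) (m≤n⊔m m n)))

  enumerate-sound : ∀ {c x m n y z} → T c x m ≡ just y →
                    (T c x n >>= decode) ≡ just z → decode y ≡ just z
  enumerate-sound {c} {x} {n = n} p q with T c x n in r
  -- A `nothing` here would make the bind `nothing`, against `q`.
  ... | just _ = trans (cong decode (T-functional p r)) q

  enumerate-≡ran : ∀ {c f} → T ⊢ c ∼ (encode ∘ f) → enumerate T c ≡ran f
  enumerate-≡ran {c} {f} c∼f x = mk⇔ sound complete
    where
    sound : (∃ᵖ[ n ] enumerate T c n ≡ just x) → ∃ᵖ[ n ] f n ≡ just x
    sound e Q irr k = e Q irr λ n p →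
      let i , _ = unpair n in
      -- The step at which `c∼f` yields `suc` or `zero` may differ from the one in `unpair n`;
      -- single-valuedness reconciles them.
      c∼f i Q irr λ _ q →
      k i (trans (sym (decode-encode (f i))) (enumerate-sound q p))

    complete : (∃ᵖ[ n ] f n ≡ just x) → ∃ᵖ[ n ] enumerate T c n ≡ just x
    complete e Q irr k = e Q irr λ i p → c∼f i Q irr λ m q →
      -- The index codes an input where `f` emits `x` and a step at which `c` has halted on it.
      let n , r = unpair-surjective i m in
      k n (trans (cong (λ im → uncurry (T c) im >>= decode) r)
          (trans (cong (_>>= decode) q)
          (trans (decode-encode (f i)) p)))

theorem7 : (T : StepFunction) → IsAbstractComputationFunction T → CT T → EA
-- `φ` is data, so it is built from `T` alone; the code from `ct` is available only inside the
-- proposition `Q`.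
theorem7 T mono ct = enumerate T , λ f Q irr k →
  ct (encode ∘ f) Q irr λ c c∼f → k c (enumerate-≡ran mono c∼f)
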